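{- For any graph $G$ without isolated vertices and any graph $H$, $$\gamma_R^p(G\circ H)\le \gamma^p(G)\,(|V(H)|+1).$$
   Context: All graphs are finite, simple and undirected, with at least one vertex. A set $S\subseteq V(G)$ is a perfect dominating set if every vertex of $V(G)\setminus S$ is adjacent to exactly one vertex of $S$; $\gamma^p(G)$ is the minimum size of a perfect dominating set. A perfect Roman dominating function (PRDF) on a graph $\Gamma$ is a function $f:V(\Gamma)\to\{0,1,2\}$ such that every vertex $u$ with $f(u)=0$ is adjacent to exactly one vertex $v$ with $f(v)=2$. Its weight is $\sum_{v}f(v)$, and $\gamma_R^p(\Gamma)$ is the minimum weight of a PRDF on $\Gamma$. The lexicographic product $G\circ H$ has vertex set $V(G)\times V(H)$, with $(u,v)$ adjacent to $(x,y)$ iff $ux\in E(G)$, or $u=x$ and $vy\in E(H)$. -}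

module Defs where

import Algebra.Properties.CommutativeMonoid.Sum
open import Data.Fin using (Fin; toℕ; funToFin; finToFun)
open import Data.Fin.Patterns using (0F; 1F; 2F)
import Data.Fin.Properties as Fin
open import Data.Fin.Subset using (Subset; _∈_; _∉_; ∣_∣; ⊤)
open import Data.Fin.Subset.Properties using (_∈?_; anySubset?; ∈⊤)
open import Data.Nat using (ℕ; zero; suc; _*_; _^_; _≤_; z≤n; s≤s; NonZero; _≟_)
open import Data.Nat.Properties using (+-0-commutativeMonoid; m*n≢0)
open import Data.Product using (∃; ∃!; _×_; _,_; proj₁; proj₂)
open import Data.Product.Function.NonDependent.Propositional using (_×-↔_)
open import Data.Sum using (_⊎_; inj₁; inj₂; [_,_])
open import Function using (_∘_; _↔_; Inverse)
open import Function.Construct.Composition using (_↔-∘_)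
open import Function.Construct.Symmetry using (↔-sym)
open import Relation.Binary.Definitions using (Decidable; Symmetric; DecidableEquality)
open import Relation.Binary.PropositionalEquality
  using (_≡_; refl; sym; trans; cong; subst)
open import Relation.Nullary using (Dec; yes; no; ¬_; contradiction)
open import Relation.Nullary.Decidable using (map′; ¬?; _×-dec_; _⊎-dec_; _→-dec_)
import Relation.Unary as Unary

open Algebra.Properties.CommutativeMonoid.Sum +-0-commutativeMonoid public
  using (sum; sum-cong-≗)

-- `Adj` may have several proofs for one pair of vertices; every notion below
-- depends only on whether it is inhabited, so the graphs are simple.
record Graph : Set₁ where
  field
    Vertex   : Set
    order    : ℕ
    nonEmpty : NonZero order
    index    : Vertex ↔ Fin order
    Adj      : Vertex → Vertex → Set
    adj?     : Decidable Adj
    symAdj   : Symmetric Adj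
    irrefl   : ∀ v → ¬ Adj v v

  toIndex : Vertex → Fin order
  toIndex = Inverse.to index

  fromIndex : Fin order → Vertex
  fromIndex = Inverse.from index

  from-to : ∀ v → fromIndex (toIndex v) ≡ v
  from-to = Inverse.strictlyInverseʳ index

  infix 4 _≟ᵛ_
  _≟ᵛ_ : DecidableEquality Vertex
  v ≟ᵛ w = map′
    (λ eq → trans (sym (from-to v)) (trans (cong fromIndex eq) (from-to w)))
    (cong toIndex)
    (toIndex v Fin.≟ toIndex w)

  all? : {P : Vertex → Set} → Unary.Decidable P → Dec (∀ v → P v)
  all? {P} P? = map′
    (λ h v → subst P (from-to v) (h (toIndex v)))
    (λ h i → h (fromIndex i))
    (Fin.all? (P? ∘ fromIndex))

  any? : {P : Vertex → Set} → Unary.Decidable P → Dec (∃ P)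
  any? {P} P? = map′
    (λ (i , p) → fromIndex i , p)
    (λ (v , p) → toIndex v , subst P (sym (from-to v)) p)
    (Fin.any? (P? ∘ fromIndex))

  ∃!? : {P : Vertex → Set} → Unary.Decidable P → Dec (∃! _≡_ P)
  ∃!? P? = any? λ v → P? v ×-dec
    map′ (λ h {w} → h w) (λ h w → h {w}) (all? λ w → P? w →-dec (v ≟ᵛ w))

NoIsolatedVertices : Graph → Set
NoIsolatedVertices G = ∀ v → ∃ λ w → Adj v w
  where open Graph G

infixr 7 _∘ˡ_

_∘ˡ_ : Graph → Graph → Graph
G ∘ˡ H = record
  { Vertex   = G.Vertex × H.Vertex
  ; order    = G.order * H.order
  ; nonEmpty = m*n≢0 G.order H.order {{G.nonEmpty}} {{H.nonEmpty}}
  ; index    = ↔-sym Fin.*↔× ↔-∘ (G.index ×-↔ H.index)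
  ; Adj      = λ (u , v) (x , y) → G.Adj u x ⊎ (u ≡ x × H.Adj v y)
  ; adj?     = λ (u , v) (x , y) →
                 G.adj? u x ⊎-dec ((u G.≟ᵛ x) ×-dec H.adj? v y)
  ; symAdj   = [ inj₁ ∘ G.symAdj
               , (λ (u≡x , vy) → inj₂ (sym u≡x , H.symAdj vy)) ]
  ; irrefl   = λ (u , v) → [ G.irrefl u , H.irrefl v ∘ proj₂ ]
  }
  where
  module G = Graph G
  module H = Graph H

IsLeast : (ℕ → Set) → ℕ → Set
IsLeast P k = P k × (∀ {j} → P j → k ≤ j)

least : {P : ℕ → Set} → Unary.Decidable P → ∀ k → P k → ∃ (IsLeast P)
least P? zero    p = zero , p , λ _ → z≤n
least P? (suc k) p with P? zero
... | yes p₀ = zero , p₀ , λ _ → z≤n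
... | no ¬p₀ with least (P? ∘ suc) k p
...   | j , pj , min = suc j , pj ,
        λ { {zero} q → contradiction q ¬p₀ ; {suc i} q → s≤s (min q) }

module _ (G : Graph) where
  open Graph G

  -- A set of vertices is represented by the set of its indices.
  PerfectDominating : Subset order → Set
  PerfectDominating S =
    ∀ v → toIndex v ∉ S → ∃! _≡_ λ w → toIndex w ∈ S × Adj v w

  perfectDominating? : Unary.Decidable PerfectDominating
  perfectDominating? S = all? λ v → ¬? (toIndex v ∈? S) →-dec
    ∃!? λ w → (toIndex w ∈? S) ×-dec adj? v w

  PDSize : ℕ → Set
  PDSize k = ∃ λ S → PerfectDominating S × ∣ S ∣ ≡ k

  γᵖ-least : ∃ (IsLeast PDSize)
  γᵖ-least = least
    (λ k → anySubset? λ S → perfectDominating? S ×-dec (∣ S ∣ ≟ k))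
    _ (⊤ , (λ v v∉⊤ → contradiction ∈⊤ v∉⊤) , refl)

  γᵖ : ℕ
  γᵖ = proj₁ γᵖ-least

  PRDF : (Vertex → Fin 3) → Set
  PRDF f = ∀ u → f u ≡ 0F → ∃! _≡_ λ v → Adj u v × f v ≡ 2F

  weight : (Vertex → Fin 3) → ℕ
  weight f = sum λ i → toℕ (f (fromIndex i))

  PRDFWeight : ℕ → Set
  PRDFWeight k = ∃ λ f → PRDF f × weight f ≡ k

  PRDF-resp-≗ : ∀ {f g} → (∀ v → f v ≡ g v) → PRDF f → PRDF g
  PRDF-resp-≗ f≗g Pf u gu≡0 with Pf u (trans (f≗g u) gu≡0)
  ... | v , (uv , fv≡2) , unique =
    v , (uv , trans (sym (f≗g v)) fv≡2) ,
    λ {w} (uw , gw≡2) → unique (uw , trans (f≗g w) gw≡2)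

  prdf? : Unary.Decidable PRDF
  prdf? f = all? λ u → (f u Fin.≟ 0F) →-dec
    ∃!? λ v → adj? u v ×-dec (f v Fin.≟ 2F)

  -- `funToFin` and `finToFun` enumerate the functions Fin order → Fin 3 by
  -- Fin (3 ^ order), which makes the search over all labellings finite.
  prdfWeight? : Unary.Decidable PRDFWeight
  prdfWeight? k = map′
    (λ (c , p) → decode c , p)
    (λ (f , Pf , wf) → encode f
      , PRDF-resp-≗ (λ v → sym (decode-encode f v)) Pf
      , trans (sum-cong-≗ λ i → cong toℕ (decode-encode f (fromIndex i))) wf)
    (Fin.any? λ c → prdf? (decode c) ×-dec (weight (decode c) ≟ k))
    where
    decode : Fin (3 ^ order) → Vertex → Fin 3
    decode c = finToFun c ∘ toIndex

    encode : (Vertex → Fin 3) → Fin (3 ^ order)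
    encode f = funToFin (f ∘ fromIndex)

    decode-encode : ∀ f v → decode (encode f) v ≡ f v
    decode-encode f v = trans
      (Fin.finToFun-funToFin (f ∘ fromIndex) (toIndex v))
      (cong f (from-to v))

  γᴿᵖ-least : ∃ (IsLeast PRDFWeight)
  γᴿᵖ-least = least prdfWeight? _ ((λ _ → 1F) , (λ _ ()) , refl)

  γᴿᵖ : ℕ
  γᴿᵖ = proj₁ γᴿᵖ-least

{-# OPTIONS --safe #-}
module Submission where

open import Defs
open import Algebra.Properties.CommutativeMonoid.Sum using (sum-replicate-zero)
open import Data.Bool using (Bool; true; false)
open import Data.Fin using (Fin; zero; suc; toℕ; _↑ˡ_; _↑ʳ_; combine; remQuot)
open import Data.Fin.Patterns using (0F; 1F; 2F)
open import Data.Fin.Properties using (remQuot-combine)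
open import Data.Fin.Subset using (Subset; _∈_; ∣_∣)
open import Data.Nat using (ℕ; zero; suc; _+_; _*_; _≤_; NonZero)
open import Data.Nat.Properties using (+-assoc; +-comm; +-0-commutativeMonoid)
open import Data.Product using (∃!; _×_; _,_; proj₁; proj₂)
open import Data.Sum using (inj₁; inj₂)
open import Data.Vec using ([]; _∷_; lookup)
open import Data.Vec.Properties using ([]=⇒lookup; lookup⇒[]=)
open import Function using (Inverse)
open import Relation.Binary.PropositionalEquality
  using (_≡_; refl; sym; trans; cong; cong₂; module ≡-Reasoning)
open import Relation.Nullary using (¬_)

-- From a minimum perfect dominating set S of G, label the fibre over each
-- vertex of S with a single 2 and otherwise 1s, and every other fibre with 0s.
-- A vertex (u , v) labelled 0 has u ∉ S, so it is adjacent to whole fibres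
-- only, and exactly one of those lies over S and contributes one 2.

sum-+ : ∀ m {n} (t : Fin (m + n) → ℕ) →
  sum t ≡ sum (λ i → t (i ↑ˡ n)) + sum (λ j → t (m ↑ʳ j))
sum-+ zero    t = refl
sum-+ (suc m) t = trans
  (cong (t zero +_) (sum-+ m (λ i → t (suc i))))
  (sym (+-assoc (t zero) _ _))

-- `combine` lays out `Fin (m * n)` as `m` consecutive blocks of length `n`, so `sum-+` splits off
-- the first block and induction handles the rest.
sum-combine : ∀ m {n} (t : Fin (m * n) → ℕ) →
  sum t ≡ sum {m} (λ i → sum {n} (λ j → t (combine i j)))
sum-combine zero        t = refl
sum-combine (suc m) {n} t = trans
  (sum-+ n t)
  (cong (sum (λ j → t (j ↑ˡ (m * n))) +_) (sum-combine m (λ i → t (n ↑ʳ i))))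

-- The `Bool` is the entry of a `Subset` at the base vertex. The place of the 2 within the fibre is
-- arbitrary; index `zero` is chosen.
fibreLabel : ∀ {n} → Bool → Fin n → Fin 3
fibreLabel false _       = 0F
fibreLabel true  zero    = 2F
fibreLabel true  (suc _) = 1F

fibreLabel≡0⇒false : ∀ {n} b (j : Fin n) → fibreLabel b j ≡ 0F → b ≡ false
fibreLabel≡0⇒false false _       _ = refl
fibreLabel≡0⇒false true  zero    ()
fibreLabel≡0⇒false true  (suc _) ()

fibreLabel≡2⇒true : ∀ {n} b (j : Fin n) → fibreLabel b j ≡ 2F → b ≡ true
fibreLabel≡2⇒true true _ _ = refl

∃!-fibreLabel≡2 : ∀ n → NonZero n →
  ∃! _≡_ λ (j : Fin n) → fibreLabel true j ≡ 2F
∃!-fibreLabel≡2 (suc n) _ = zero , refl , λ { {zero} _ → refl }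

sum-const-1 : ∀ n → sum {n} (λ _ → 1) ≡ n
sum-const-1 zero    = refl
sum-const-1 (suc n) = cong suc (sum-const-1 n)

-- The single 2 exceeds an all-ones fibre by one; a fibre must be nonempty to hold it.
sum-fibreLabel-true : ∀ n → NonZero n →
  sum {n} (λ j → toℕ (fibreLabel true j)) ≡ n + 1
sum-fibreLabel-true (suc n) _ = trans
  (cong (2 +_) (sum-const-1 n))
  (cong suc (+-comm 1 n))

sum-fibreLabel : ∀ {m} n → NonZero n → (S : Subset m) →
  sum (λ i → sum {n} (λ j → toℕ (fibreLabel (lookup S i) j))) ≡ ∣ S ∣ * (n + 1)
sum-fibreLabel n n≢0 []          = refl
sum-fibreLabel n n≢0 (false ∷ S) = cong₂ _+_ (sum-replicate-zero +-0-commutativeMonoid n) (sum-fibreLabel n n≢0 S)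
sum-fibreLabel n n≢0 (true ∷ S)  =
  cong₂ _+_ (sum-fibreLabel-true n n≢0) (sum-fibreLabel n n≢0 S)

module _ (G H : Graph) (S : Subset (Graph.order G)) where
  private
    module G = Graph G
    module H = Graph H
    module G∘H = Graph (G ∘ˡ H)

  liftLabel : G∘H.Vertex → Fin 3
  liftLabel (u , v) = fibreLabel (lookup S (G.toIndex u)) (H.toIndex v)

  liftLabel-PRDF : PerfectDominating G S → PRDF (G ∘ˡ H) liftLabel
  liftLabel-PRDF dominating (u , v) label≡0
    with dominating u u∉S | ∃!-fibreLabel≡2 H.order H.nonEmpty
    where
    u∉S : ¬ G.toIndex u ∈ S
    -- Label 0 forces the entry of `S` at `u` to be `false`.
    u∉S u∈S
      with () ← trans (sym ([]=⇒lookup u∈S)) (fibreLabel≡0⇒false _ (H.toIndex v) label≡0)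
  ... | w , (w∈S , uw) , w-unique | j , j≡2 , j-unique =
    (w , H.fromIndex j) , (inj₁ uw , label≡2) , unique
    where
    label≡2 : liftLabel (w , H.fromIndex j) ≡ 2F
    label≡2 = trans
      (cong₂ fibreLabel ([]=⇒lookup w∈S) (Inverse.strictlyInverseˡ H.index j)) j≡2

    unique : ∀ {z} → G∘H.Adj (u , v) z × liftLabel z ≡ 2F → (w , H.fromIndex j) ≡ z
    unique {x , y} (uv~xy , xy≡2) with fibreLabel≡2⇒true _ (H.toIndex y) xy≡2
    -- An edge of `G` leads to a fibre over `S`: domination fixes the base vertex, and the single 2
    -- of the fibre fixes the position.
    unique {x , y} (inj₁ ux , xy≡2) | x∈S = cong₂ _,_
      (w-unique (lookup⇒[]= _ S x∈S , ux))
      (trans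
        (cong H.fromIndex
          (j-unique (trans (cong (λ b → fibreLabel b (H.toIndex y)) (sym x∈S)) xy≡2)))
        (H.from-to y))
    -- A 2 inside the fibre over `u` would put `u` in `S`, against its label 0.
    unique {x , y} (inj₂ (refl , _) , xy≡2) | x∈S
      with () ← trans (sym x∈S) (fibreLabel≡0⇒false _ (H.toIndex v) label≡0)

  weight-liftLabel : weight (G ∘ˡ H) liftLabel ≡ ∣ S ∣ * (H.order + 1)
  weight-liftLabel = begin
    weight (G ∘ˡ H) liftLabel
      ≡⟨ sum-combine G.order {H.order} _ ⟩
    sum {G.order} (λ i → sum {H.order} (λ j → toℕ (liftLabel (G∘H.fromIndex (combine i j)))))
      ≡⟨ sum-cong-≗ {G.order} (λ i → sum-cong-≗ {H.order} (λ j → cong toℕ (label-combine i j))) ⟩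
    sum {G.order} (λ i → sum {H.order} (λ j → toℕ (fibreLabel (lookup S i) j)))
      ≡⟨ sum-fibreLabel H.order H.nonEmpty S ⟩
    ∣ S ∣ * (H.order + 1) ∎
    where
    open ≡-Reasoning

    -- The product's `fromIndex` is `remQuot` followed by those of `G` and `H`; `remQuot` cancels
    -- `combine`, and the `toIndex` calls in `liftLabel` cancel the rest.
    label-combine : ∀ i j →
      liftLabel (G∘H.fromIndex (combine i j)) ≡ fibreLabel (lookup S i) j
    label-combine i j = trans
      (cong (λ (k , l) → liftLabel (G.fromIndex k , H.fromIndex l)) (remQuot-combine i j))
      (cong₂ (λ k l → fibreLabel (lookup S k) l)
        (Inverse.strictlyInverseˡ G.index i) (Inverse.strictlyInverseˡ H.index j))

γᵖ-attained : ∀ G → PDSize G (γᵖ G)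
γᵖ-attained G = proj₁ (proj₂ (γᵖ-least G))

γᴿᵖ-minimal : ∀ G {k} → PRDFWeight G k → γᴿᵖ G ≤ k
γᴿᵖ-minimal G = proj₂ (proj₂ (γᴿᵖ-least G))

theorem4p1 : ∀ (G H : Graph) → NoIsolatedVertices G →
    γᴿᵖ (G ∘ˡ H) ≤ γᵖ G * (Graph.order H + 1)
theorem4p1 G H _ with γᵖ-attained G
-- By minimality of `γᴿᵖ`, a single PRDF of the required weight suffices.
... | S , dominating , ∣S∣≡γᵖ = γᴿᵖ-minimal (G ∘ˡ H)
  ( liftLabel G H S
  , liftLabel-PRDF G H S dominating
  , trans (weight-liftLabel G H S) (cong (_* (Graph.order H + 1)) ∣S∣≡γᵖ))
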